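{- Let $\mathcal G=((V,E),(V_1,V_2))$ be a game graph with GR(1) objective $\bigwedge_{t=1}^{k_1}\text{Büchi}(L_t)\rightarrow\bigwedge_{\ell=1}^{k_2}\text{Büchi}(U_\ell)$ for player 1, and let $V^{j^*}$ be the set of vertices returned by Algorithm GR(1)Game (described in the context) on this input. Then each vertex in $V^{j^*}$ is winning for player 1, i.e. from each vertex of $V^{j^*}$ player 1 has a winning strategy in $\mathcal G$ for the GR(1) objective.
   Context: **Games.** A game graph $\mathcal G=((V,E),(V_1,V_2))$ is a finite directed graph with a partition of $V$ into player-1 vertices $V_1$ and player-2 vertices $V_2$, every vertex having at least one outgoing edge; $n=|V|$, $m=|E|$. $\overline{\mathcal G}=((V,E),(V_2,V_1))$ swaps the players. $\mathrm{Out},\mathrm{In}$ denote successor and predecessor sets, $\mathrm{Outdeg}(v)=|\mathrm{Out}(v)|$ (a graph is added as an argument if needed). A play is an infinite path; at a vertex of $V_p$ player $p$ picks the successor by a strategy (function of the history). $\text{Büchi}(T)$ is the set of plays visiting $T$ infinitely often. A generalized Büchi objective is a conjunction of Büchi objectives; the GR(1) objective $\bigwedge_{t=1}^{k_1}\text{Büchi}(L_t)\rightarrow\bigwedge_{\ell=1}^{k_2}\text{Büchi}(U_\ell)$ is the set of plays that satisfy the second conjunction or violate the first. Player 2 has the complement of player 1's objective. $W_p(\mathcal G,\psi)$ is the set of vertices from which player $p$ has a winning strategy when player 1's objective is $\psi$. **Attractors.** For $p\in\{1,2\}$ with opponent $\bar p$ and $X\subseteq V$: $R_0=X$, $R_{j+1}=R_j\cup\{v\in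 V_p\mid \mathrm{Out}(v)\cap R_j\ne\emptyset\}\cup\{v\in V_{\bar p}\mid \mathrm{Out}(v)\subseteq R_j\}$, $\mathit{Attr}_p(\mathcal G,X)=\bigcup_j R_j$. $\mathcal G\setminus X$ is the game graph induced by $V\setminus X$. **Hierarchical graph decomposition.** For a game graph on $G=(V,E)$, fix for each vertex an order of its incoming edges in which edges from $V_2$ precede edges from $V_1$. For $i\ge1$, $G_i=(V,E_i)$, where $E_i$ contains all outgoing edges of every $v$ with $\mathrm{Outdeg}(G,v)\le 2^i$ and the first $2^i$ incoming edges of every vertex; $\mathcal G_i=(G_i,(V_1,V_2))$. **Subroutines.** GenBüchiGame$(\mathcal H,\psi)$, for a generalized Büchi objective $\psi$ of player 1 in $\mathcal H$, returns $W_1(\mathcal H,\psi)$. GenBüchiProgressMeasure$(\mathcal H,\psi,h)$ returns either the empty set or a player-1 dominion of $\mathcal H$ w.r.t. $\psi$ (a non-empty vertex set $D$ such that player 1 has, from every vertex of $D$, a strategy that is winning for $\psi$ and ensures that only vertices of $D$ are visited); if there is a player-1 dominion of size at most $h$, it returns a player-1 dominion containing all player-1 dominions of size at most $h$. **Procedure kGenBüchiDominion**$(\mathcal G^j,\{U^j_\ell\},\{L^j_t\},h_{\max})$. For $i=1,\dots,\lceil\log_2(2h_{\max})\rceil$: construct $G^j_i$ (the $i$th graph of the decomposition of the graph $G^j$ of $\mathcal G^j$, with vertex set $V^j$); let $Z^j_i=\{v\in V_2\cap V^j\mid \mathrm{Outdeg}(G^j_i,v)=0\}\cup\{v\in V_1\cap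 V^j\mid\mathrm{Outdeg}(G^j,v)>2^i\}$; for $\ell=1,\dots,k_2$: let $Y^j_{i,\ell}=\mathit{Attr}_1(\mathcal G^j_i,U^j_\ell\cup Z^j_i)$ and $X^j_{i,\ell}=$ GenBüchiProgressMeasure$(\overline{\mathcal G^j_i\setminus Y^j_{i,\ell}},\bigwedge_{t=1}^{k_1}\text{Büchi}(L^j_t\setminus Y^j_{i,\ell}),2^i)$; if $X^j_{i,\ell}\ne\emptyset$, return $X^j_{i,\ell}$. If nothing was returned, return $\emptyset$. **Algorithm GR(1)Game.** Set $\mathcal G^1=\mathcal G$, $U^1_\ell=U_\ell$, $L^1_t=L_t$. For $j=1,2,\dots$: let $V^j$ be the vertex set of $\mathcal G^j$ and $S^j=$ kGenBüchiDominion$(\mathcal G^j,\{U^j_\ell\},\{L^j_t\},\sqrt n)$, where $n=|V|$. If $S^j=\emptyset$, then for $\ell=1,\dots,k_2$: let $Y^j_\ell=\mathit{Attr}_1(\mathcal G^j,U^j_\ell)$ and $S^j=$ GenBüchiGame$(\overline{\mathcal G^j\setminus Y^j_\ell},\bigwedge_{t=1}^{k_1}\text{Büchi}(L^j_t\setminus Y^j_\ell))$, leaving this loop as soon as $S^j\ne\emptyset$. Then let $D^j=\mathit{Attr}_2(\mathcal G^j,S^j)$, $\mathcal G^{j+1}=\mathcal G^j\setminus D^j$, $U^{j+1}_\ell=U^j_\ell\setminus D^j$, $L^{j+1}_t=L^j_t\setminus D^j$. If $D^j=\emptyset$, stop and return $V^j$ (this $j$ is denoted $j^*$). -}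

module Defs where

open import Data.Empty using (⊥-elim)
open import Data.Fin using (Fin)
import Data.Fin as Fin
open import Data.Fin.Properties using (any?)
open import Data.Fin.Subset using (Subset; _∈_; _⊆_; _⊂_; _∪_; _─_; ∣_∣; Nonempty; Empty)
  renaming (⊥ to ∅)
open import Data.Fin.Subset.Properties
  using (_∈?_; _⊆?_; nonempty?; ∣p∣≤n; p⊂q⇒∣p∣<∣q∣; p⊆p∪q; x∈p∪q⁺; x∈p∪q⁻)
open import Data.List using (List; []; _∷_; map; concatMap; foldr; take; upTo; allFin)
import Data.List.Membership.Propositional as List
import Data.List.Membership.DecPropositional as DecList
open import Data.List.Relation.Unary.AllPairs using (AllPairs)
open import Data.List.Relation.Unary.Unique.Propositional using (Unique)
open import Data.Nat using (ℕ; zero; suc; _+_; _*_; _^_; _≤_; _<_; _≤?_; _≟_; _<?_; z≤n; ⌈_/2⌉)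
open import Data.Nat.GeneralisedArithmetic using (fold)
open import Data.Nat.Logarithm using (⌈log₂_⌉)
open import Data.Nat.Properties
  using (≤-trans; ≤-<-trans; <-irrefl; +-comm)
open import Data.Product using (Σ; _×_; _,_; proj₁; proj₂; ∃-syntax)
open import Data.Sum using (_⊎_; inj₁; inj₂)
open import Data.Vec using (tabulate)
open import Data.Vec.Properties using (lookup∘tabulate; []=⇒lookup; lookup⇒[]=)
open import Data.Bool using (true; if_then_else_)
open import Function using (_∘_; _⇔_; mk⇔)
open import Relation.Binary.PropositionalEquality using (_≡_; refl; sym; trans; subst)
open import Relation.Nullary using (¬_; Dec; yes; no; does)
open import Relation.Nullary.Decidable using (_×-dec_; _⊎-dec_; ¬?)
open import Relation.Unary using (Decidable)

private
  variable
    N : ℕ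

⟨_⟩ : {P : Fin N → Set} → Decidable P → Subset N
⟨ P? ⟩ = tabulate (does ∘ P?)

∈⟨⟩⁺ : {P : Fin N → Set} (P? : Decidable P) {v : Fin N} → P v → v ∈ ⟨ P? ⟩
∈⟨⟩⁺ P? {v} p = lookup⇒[]= v _ (trans (lookup∘tabulate (does ∘ P?) v) (holds (P? v)))
  where
  holds : (d : Dec _) → does d ≡ true
  holds (yes _) = refl
  holds (no ¬p) = ⊥-elim (¬p p)

∈⟨⟩⁻ : {P : Fin N → Set} (P? : Decidable P) {v : Fin N} → v ∈ ⟨ P? ⟩ → P v
∈⟨⟩⁻ P? {v} v∈ = holds (P? v) (trans (sym (lookup∘tabulate (does ∘ P?) v)) ([]=⇒lookup v∈))
  where
  holds : (d : Dec _) → does d ≡ true → _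
  holds (yes p) _ = p

data Player : Set where
  one two : Player

opponent : Player → Player
opponent one = two
opponent two = one

_≟ᴾ_ : (p q : Player) → Dec (p ≡ q)
one ≟ᴾ one = yes refl
one ≟ᴾ two = no λ ()
two ≟ᴾ one = no λ ()
two ≟ᴾ two = yes refl

-- All graphs live inside a fixed finite set Fin N, so that a subgraph has the
-- same type as the graph. The partition of V is given by `owner`, whose values
-- outside V are irrelevant. Vertices may lack outgoing edges here, because the
-- graphs of the decomposition below can have sinks; a game graph is an arena
-- satisfying `Total`.
record Arena (N : ℕ) : Set where
  field
    V     : Subset N
    owner : Fin N → Player
    Out   : Fin N → Subset N
    E⊆V×V : ∀ {v u} → u ∈ Out v → v ∈ V × u ∈ V

  _∈V[_] : Fin N → Player → Set
  v ∈V[ p ] = v ∈ V × owner v ≡ p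

  _∈V?[_] : ∀ v p → Dec (v ∈V[ p ])
  v ∈V?[ p ] = (v ∈? V) ×-dec (owner v ≟ᴾ p)

  Outdeg : Fin N → ℕ
  Outdeg v = ∣ Out v ∣

open Arena public

Total : Arena N → Set
Total G = ∀ v → v ∈ V G → Nonempty (Out G v)

swap : Arena N → Arena N
swap G = record
  { V = V G ; owner = opponent ∘ owner G ; Out = Out G ; E⊆V×V = E⊆V×V G }

infixl 5 _∖_

_∖_ : Arena N → Subset N → Arena N
G ∖ X = record
  { V     = V G ─ X
  ; owner = owner G
  ; Out   = λ v → ⟨ edge? v ⟩
  ; E⊆V×V = λ {v} u∈ → proj₂ (∈⟨⟩⁻ (edge? v) u∈)
  }
  where
  edge? : ∀ v → Decidable (λ u → u ∈ Out G v × (v ∈ V G ─ X × u ∈ V G ─ X))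
  edge? v u = (u ∈? Out G v) ×-dec ((v ∈? (V G ─ X)) ×-dec (u ∈? (V G ─ X)))

Play : ℕ → Set
Play N = ℕ → Fin N

IsPlay : Arena N → Play N → Set
IsPlay G π = π 0 ∈ V G × (∀ i → π (suc i) ∈ Out G (π i))

-- π (i - 1) , … , π 0
past : Play N → ℕ → List (Fin N)
past π zero    = []
past π (suc i) = π i ∷ past π i

-- The arguments of `move` are the earlier vertices, latest first, and the
-- current vertex.
record Strategy (p : Player) (G : Arena N) : Set where
  field
    move  : List (Fin N) → Fin N → Fin N
    legal : ∀ h v → _∈V[_] G v p → move h v ∈ Out G v

open Strategy public

Consistent : (p : Player) (G : Arena N) → Strategy p G → Play N → Set
Consistent p G σ π = ∀ i → _∈V[_] G (π i) p → π (suc i) ≡ move σ (past π i) (π i)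

Objective : ℕ → Set₁
Objective N = Play N → Set

Büchi : Subset N → Objective N
Büchi T π = ∀ i → ∃[ j ] (i ≤ j × π j ∈ T)

GenBüchi : ∀ {k} → (Fin k → Subset N) → Objective N
GenBüchi T π = ∀ t → Büchi (T t) π

-- "The second conjunction holds or the first fails", stated as an implication:
-- deciding which alternative holds of an infinite play is not constructive.
GR1 : ∀ {k₁ k₂} → (Fin k₁ → Subset N) → (Fin k₂ → Subset N) → Objective N
GR1 L U π = GenBüchi L π → GenBüchi U π

playerObjective : Player → Objective N → Objective N
playerObjective one ψ π = ψ π
playerObjective two ψ π = ¬ ψ π

_∈W[_,_,_] : Fin N → Player → Arena N → Objective N → Set
v ∈W[ p , G , ψ ] =
  v ∈ V G × Σ (Strategy p G) λ σ →
    ∀ π → IsPlay G π → π 0 ≡ v → Consistent p G σ π → playerObjective p ψ π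

record Dominion (G : Arena N) (ψ : Objective N) (D : Subset N) : Set where
  field
    nonempty : Nonempty D
    within   : D ⊆ V G
    winning  : ∀ v → v ∈ D → Σ (Strategy one G) λ σ →
      ∀ π → IsPlay G π → π 0 ≡ v → Consistent one G σ π → ψ π × (∀ i → π i ∈ D)

module _ (p : Player) (G : Arena N) where

  Attracted : Subset N → Fin N → Set
  Attracted R v = (_∈V[_] G v p × ∃[ u ] (u ∈ Out G v × u ∈ R))
                ⊎ (_∈V[_] G v (opponent p) × Out G v ⊆ R)

  attracted? : ∀ R → Decidable (Attracted R)
  attracted? R v =
    (_∈V?[_] G v p ×-dec any? (λ u → (u ∈? Out G v) ×-dec (u ∈? R)))
    ⊎-dec (_∈V?[_] G v (opponent p) ×-dec (Out G v ⊆? R))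

  attrStep : Subset N → Subset N
  attrStep R = R ∪ ⟨ attracted? R ⟩

  attrStage : Subset N → ℕ → Subset N
  attrStage X = fold X attrStep

  -- The increasing sequence of stages is constant from index N on, so this is
  -- the union of all stages, as `∈Attr⇔` shows.
  Attr : Subset N → Subset N
  Attr X = attrStage X N

  private
    Attracted-mono : ∀ {R S} → R ⊆ S → ∀ {v} → Attracted R v → Attracted S v
    Attracted-mono R⊆S (inj₁ (v∈ , u , u∈ , u∈R)) = inj₁ (v∈ , u , u∈ , R⊆S u∈R)
    Attracted-mono R⊆S (inj₂ (v∈ , Out⊆R))        = inj₂ (v∈ , R⊆S ∘ Out⊆R)

    attrStep-mono : ∀ {R S} → R ⊆ S → attrStep R ⊆ attrStep S
    attrStep-mono {R} {S} R⊆S v∈ with x∈p∪q⁻ R ⟨ attracted? R ⟩ v∈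
    ... | inj₁ v∈R = x∈p∪q⁺ (inj₁ (R⊆S v∈R))
    ... | inj₂ v∈A = x∈p∪q⁺ (inj₂ (∈⟨⟩⁺ (attracted? S) (Attracted-mono R⊆S (∈⟨⟩⁻ (attracted? R) v∈A))))

    module _ (X : Subset N) where

      grow : ∀ i → attrStage X i ⊆ attrStage X (suc i)
      grow i = p⊆p∪q ⟨ attracted? (attrStage X i) ⟩

      stable-suc : ∀ i → attrStage X (suc i) ⊆ attrStage X i →
                   attrStage X (suc (suc i)) ⊆ attrStage X (suc i)
      stable-suc i = attrStep-mono

      stable-or-large : ∀ i → attrStage X (suc i) ⊆ attrStage X i ⊎ suc i ≤ ∣ attrStage X (suc i) ∣
      stable-or-large i with attrStage X (suc i) ⊆? attrStage X i
      ... | yes stable = inj₁ stable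
      ... | no unstable = inj₂ (≤-<-trans (size i unstable) (p⊂q⇒∣p∣<∣q∣ (strict i unstable)))
        where
        strict : ∀ i → ¬ (attrStage X (suc i) ⊆ attrStage X i) → attrStage X i ⊂ attrStage X (suc i)
        strict i ns with any? (λ v → (v ∈? attrStage X (suc i)) ×-dec ¬? (v ∈? attrStage X i))
        ... | yes new = grow i , new
        ... | no none = ⊥-elim (ns λ {v} v∈ → old v v∈ (v ∈? attrStage X i))
          where
          old : ∀ v → v ∈ attrStage X (suc i) → Dec (v ∈ attrStage X i) → v ∈ attrStage X i
          old v v∈ (yes v∈i) = v∈i
          old v v∈ (no v∉i)  = ⊥-elim (none (v , v∈ , v∉i))
        size : ∀ i → ¬ (attrStage X (suc i) ⊆ attrStage X i) → i ≤ ∣ attrStage X i ∣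
        size zero    _  = z≤n
        size (suc i) ns = ≤-<-trans (size i ns′) (p⊂q⇒∣p∣<∣q∣ (strict i ns′))
          where
          ns′ : ¬ (attrStage X (suc i) ⊆ attrStage X i)
          ns′ = ns ∘ stable-suc i

      Attr-stable : attrStage X (suc N) ⊆ Attr X
      Attr-stable with stable-or-large N
      ... | inj₁ stable = stable
      ... | inj₂ large  = ⊥-elim (<-irrefl refl (≤-trans large (∣p∣≤n (attrStage X (suc N)))))

      beyond : ∀ i → attrStage X (i + N) ⊆ Attr X
      beyond zero    v∈ = v∈
      beyond (suc i) v∈ = Attr-stable (attrStep-mono (beyond i) v∈)

      grow* : ∀ k i → attrStage X i ⊆ attrStage X (k + i)
      grow* zero    i v∈ = v∈
      grow* (suc k) i v∈ = grow (k + i) (grow* k i v∈)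

  ∈Attr⇔ : ∀ X v → v ∈ Attr X ⇔ (∃[ j ] v ∈ attrStage X j)
  ∈Attr⇔ X v = mk⇔ (λ v∈ → N , v∈)
    (λ { (j , v∈) → beyond X j (subst (λ k → v ∈ attrStage X k) (+-comm N j) (grow* X N j v∈)) })

-- The incoming edges of a vertex are given by their tails.
record InEdgeOrder (G : Arena N) : Set where
  field
    tails    : Fin N → List (Fin N)
    unique   : ∀ v → Unique (tails v)
    complete : ∀ v u → u List.∈ tails v ⇔ v ∈ Out G u
    V₂-first : ∀ v → AllPairs (λ u w → ¬ (_∈V[_] G u one × _∈V[_] G w two)) (tails v)

open InEdgeOrder public

decomposition : (G : Arena N) → InEdgeOrder G → ℕ → Arena N
decomposition {N} G ord i = record
  { V     = V G
  ; owner = owner G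
  ; Out   = λ v → ⟨ edge? v ⟩
  ; E⊆V×V = λ {v} u∈ → E⊆V×V G (proj₁ (∈⟨⟩⁻ (edge? v) u∈))
  }
  where
  open DecList (Fin._≟_ {N}) using () renaming (_∈?_ to _∈ᴸ?_)
  edge? : ∀ v → Decidable (λ u →
    u ∈ Out G v × (Outdeg G v ≤ 2 ^ i ⊎ v List.∈ take (2 ^ i) (tails ord u)))
  edge? v u = (u ∈? Out G v)
    ×-dec ((Outdeg G v ≤? 2 ^ i) ⊎-dec (v ∈ᴸ? take (2 ^ i) (tails ord u)))

record GenBüchiGame (N : ℕ) : Set where
  field
    solve : ∀ {k} → Arena N → (Fin k → Subset N) → Subset N
    correct : ∀ {k} (H : Arena N) (T : Fin k → Subset N) →
      Total H → (∀ t → T t ⊆ V H) →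
      ∀ v → v ∈ solve H T ⇔ v ∈W[ one , H , GenBüchi T ]

record GenBüchiProgressMeasure (N : ℕ) : Set where
  field
    run : ∀ {k} → Arena N → (Fin k → Subset N) → ℕ → Subset N
    sound : ∀ {k} (H : Arena N) (T : Fin k → Subset N) (h : ℕ) →
      Total H → (∀ t → T t ⊆ V H) →
      Empty (run H T h) ⊎ Dominion H (GenBüchi T) (run H T h)
    large : ∀ {k} (H : Arena N) (T : Fin k → Subset N) (h : ℕ) →
      Total H → (∀ t → T t ⊆ V H) →
      (∃[ D ] (Dominion H (GenBüchi T) D × ∣ D ∣ ≤ h)) →
      Dominion H (GenBüchi T) (run H T h)
        × (∀ D → Dominion H (GenBüchi T) D → ∣ D ∣ ≤ h → D ⊆ run H T h)

_orElse_ : Subset N → Subset N → Subset N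
S orElse T = if does (nonempty? S) then S else T

firstNonempty : List (Subset N) → Subset N
firstNonempty = foldr _orElse_ ∅

module Algorithm
  {N k₁ k₂ : ℕ}
  (order   : (H : Arena N) → InEdgeOrder H)
  (solver  : GenBüchiGame N)
  (measure : GenBüchiProgressMeasure N)
  where

  open GenBüchiGame solver
  open GenBüchiProgressMeasure measure

  record State : Set where
    constructor state
    field
      graph : Arena N
      U     : Fin k₂ → Subset N
      L     : Fin k₁ → Subset N

  open State public

  module _ (s : State) where

    Gᵢ : ℕ → Arena N
    Gᵢ = decomposition (graph s) (order (graph s))

    Zᵢ : ℕ → Subset N
    Zᵢ i = ⟨ (λ v → _∈V?[_] (graph s) v two ×-dec (Outdeg (Gᵢ i) v ≟ 0)) ⟩
         ∪ ⟨ (λ v → _∈V?[_] (graph s) v one ×-dec (2 ^ i <? Outdeg (graph s) v)) ⟩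

    Yᵢ : ℕ → Fin k₂ → Subset N
    Yᵢ i ℓ = Attr one (Gᵢ i) (U s ℓ ∪ Zᵢ i)

    Xᵢ : ℕ → Fin k₂ → Subset N
    Xᵢ i ℓ = run (swap (Gᵢ i ∖ Yᵢ i ℓ)) (λ t → L s t ─ Yᵢ i ℓ) (2 ^ i)

    -- The argument is the square of h_max, which keeps h_max = √n exact. As
    -- 2 √q = √(4 q), the bound ⌈log₂ (2 √q)⌉ is ⌈ log₂ (4 q) / 2 ⌉, which is
    -- unaffected by first rounding up the logarithm.
    kGenBüchiDominion : (hmax² : ℕ) → Subset N
    kGenBüchiDominion q =
      firstNonempty (concatMap (λ i → map (Xᵢ i) (allFin k₂))
                               (map suc (upTo ⌈ ⌈log₂ (4 * q) ⌉ /2⌉)))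

    Y : Fin k₂ → Subset N
    Y ℓ = Attr one (graph s) (U s ℓ)

    S-fallback : Subset N
    S-fallback = firstNonempty
      (map (λ ℓ → solve (swap (graph s ∖ Y ℓ)) (λ t → L s t ─ Y ℓ)) (allFin k₂))

    -- n is the number of vertices of the input graph.
    module _ (n : ℕ) where

      S : Subset N
      S = kGenBüchiDominion n orElse S-fallback

      D : Subset N
      D = Attr two (graph s) S

      next : State
      next = state (graph s ∖ D) (λ ℓ → U s ℓ ─ D) (λ t → L s t ─ D)

  module Run (G : Arena N) (L₀ : Fin k₁ → Subset N) (U₀ : Fin k₂ → Subset N) where

    -- Iterations are counted from 0.
    iteration : ℕ → State
    iteration = fold (state G U₀ L₀) (λ s → next s ∣ V G ∣)

    Vʲ Dʲ : ℕ → Subset N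
    Vʲ j = V (graph (iteration j))
    Dʲ j = D (iteration j) ∣ V G ∣

    StopsAt : ℕ → Set
    StopsAt j = Empty (Dʲ j) × (∀ i → i < j → Nonempty (Dʲ i))

{-# OPTIONS --safe #-}
module Submission where

-- When the algorithm stops, every game 𝒢 ∖ Y_ℓ with Y_ℓ = Attr₁(U_ℓ) has an
-- empty winning region for the player who wants the conjunction of Büchi(L_t).
-- Starting from R = Y_ℓ, enlarge a set R from which player 1 has a positional
-- strategy that reaches U_ℓ or violates some Büchi(L_t): attract to R, or, if
-- player 2 cannot attract some part of 𝒢 ∖ R to L_t, add that part. If neither
-- is possible, player 2 can attract all of 𝒢 ∖ R to every L_t and hence wins
-- there unless 𝒢 ∖ R is empty; so R is everything. Player 1 then pursues
-- U_1, …, U_k₂ in cyclic order. As the sets D^j removed by the algorithm are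
-- player-2 attractors, player 2 cannot enter them, and the strategy also wins
-- in the input game.

open import Defs
open import Data.Empty using (⊥-elim)
open import Data.Nat using (ℕ; zero; suc; _+_; _*_; _≤_; _<_; s≤s)
open import Data.Nat.DivMod using (_mod_; [m+kn]%n≡m%n; m<n⇒m%n≡m)
open import Data.Nat.Properties
  using (≤-refl; ≤-reflexive; ≤-trans; <⇒≱; n≤1+n; m≤m+n; m≤n⇒∃[o]m+o≡n;
         +-identityʳ; +-suc; +-comm; +-assoc; +-monoʳ-≤; *-suc)
open import Data.Fin using (Fin; toℕ)
open import Data.Fin.Properties using (any?; toℕ-fromℕ<; toℕ-injective; toℕ<n)
open import Data.Fin.Subset
  using (Subset; inside; outside; _∈_; _∉_; _⊆_; _⊂_; _∪_; _─_; ∣_∣; Nonempty; Empty)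
open import Data.Fin.Subset.Properties
  using (_∈?_; nonempty?; ∣p∣≤n; p⊂q⇒∣p∣<∣q∣; p⊆p∪q; q⊆p∪q; x∈p∪q⁻; x∈p∧x∉q⇒x∈p─q; p─q⊆p)
open import Data.List using (List; []; _∷_)
import Data.List.Membership.Propositional as List
open import Data.List.Membership.Propositional.Properties using (∈-map⁺; ∈-allFin)
open import Data.List.Relation.Unary.Any using (here; there)
open import Data.Product using (Σ; _×_; _,_; proj₁; proj₂; ∃-syntax)
open import Data.Sum using (_⊎_; inj₁; inj₂)
import Data.Vec as Vec
open import Function using (_∘_; Equivalence)
open import Relation.Binary.PropositionalEquality using (_≡_; refl; sym; trans; cong; subst)
open import Relation.Nullary using (¬_; Dec; yes; no)
open import Relation.Nullary.Decidable using (_×-dec_; ¬?)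

private
  variable
    N k k₁ k₂ : ℕ

-- Finite subsets and residues.

x∈p─q⇒x∉q : ∀ {x} (p q : Subset N) → x ∈ p ─ q → x ∉ q
x∈p─q⇒x∉q (_ Vec.∷ p) (outside Vec.∷ q) (Vec.there x∈) (Vec.there x∈q) = x∈p─q⇒x∉q p q x∈ x∈q
x∈p─q⇒x∉q (_ Vec.∷ p) (inside  Vec.∷ q) (Vec.there x∈) (Vec.there x∈q) = x∈p─q⇒x∉q p q x∈ x∈q

⊆-or-new : (p q : Subset N) → p ⊆ q ⊎ (∃[ x ] (x ∈ p × x ∉ q))
⊆-or-new p q with any? (λ x → (x ∈? p) ×-dec ¬? (x ∈? q))
... | yes new = inj₂ new
... | no none = inj₁ λ {x} x∈p → old x x∈p (x ∈? q)
  where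
  old : ∀ x → x ∈ p → Dec (x ∈ q) → x ∈ q
  old x x∈p (yes x∈q) = x∈q
  old x x∈p (no x∉q)  = ⊥-elim (none (x , x∈p , x∉q))

toℕ-mod : ∀ {m} (ℓ : Fin (suc m)) c → (toℕ ℓ + c * suc m) mod suc m ≡ ℓ
toℕ-mod {m} ℓ c = toℕ-injective (trans (toℕ-fromℕ< _)
  (trans ([m+kn]%n≡m%n (toℕ ℓ) c (suc m)) (m<n⇒m%n≡m (toℕ<n ℓ))))

-- Subgraphs, closed sets and attractors.

module _ (G : Arena N) (X : Subset N) where

  private
    -- Coincides definitionally with the local predicate in the definition of _∖_.
    edge? : ∀ v u → Dec (u ∈ Out G v × (v ∈ V G ─ X × u ∈ V G ─ X))
    edge? v u = (u ∈? Out G v) ×-dec ((v ∈? (V G ─ X)) ×-dec (u ∈? (V G ─ X)))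

  ∖-Out⁺ : ∀ {v u} → u ∈ Out G v → v ∉ X → u ∉ X → u ∈ Out (G ∖ X) v
  ∖-Out⁺ {v} u∈ v∉X u∉X =
    ∈⟨⟩⁺ (edge? v) (u∈ , x∈p∧x∉q⇒x∈p─q (proj₁ (E⊆V×V G u∈)) v∉X
                       , x∈p∧x∉q⇒x∈p─q (proj₂ (E⊆V×V G u∈)) u∉X)

  ∖-Out⁻ : ∀ {v u} → u ∈ Out (G ∖ X) v → u ∈ Out G v
  ∖-Out⁻ {v} u∈ = proj₁ (∈⟨⟩⁻ (edge? v) u∈)

-- The complement of a closed set is a trap for `p`: outside `R`, vertices of `p` have no edge into
-- `R`, and vertices of the opponent have an edge avoiding `R`.
Closed : Player → Arena N → Subset N → Set
Closed p G R = ∀ v → Attracted p G R v → v ∈ R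

owner-cases : ∀ p q → p ≡ q ⊎ p ≡ opponent q
owner-cases one one = inj₁ refl
owner-cases one two = inj₂ refl
owner-cases two one = inj₂ refl
owner-cases two two = inj₁ refl

opponent-one : ∀ {p} → opponent p ≡ one → p ≡ two
opponent-one {two} refl = refl

opponent-two : ∀ {p} → opponent p ≡ two → p ≡ one
opponent-two {one} refl = refl

module _ {N : ℕ} (p : Player) (G : Arena N) where

  Attr-⊇ : ∀ X → X ⊆ Attr p G X
  Attr-⊇ X v∈ = Equivalence.from (∈Attr⇔ p G X _) (0 , v∈)

  Attr-closed : ∀ X → Closed p G (Attr p G X)
  Attr-closed X v att = Equivalence.from (∈Attr⇔ p G X v)
    -- A vertex attracted to stage `N` lies in stage `suc N`, and by `∈Attr⇔` every stage is
    -- contained in stage `N`.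
    (suc N , q⊆p∪q (Attr p G X) _ (∈⟨⟩⁺ (attracted? p G (Attr p G X)) att))

  Total-∖ : ∀ {R} → Total G → Closed p G R → Total (G ∖ R)
  Total-∖ {R} total closed v v∈ = escape (owner-cases (owner G v) p)
    where
    v∈V : v ∈ V G
    v∈V = p─q⊆p (V G) R v∈
    v∉R : v ∉ R
    v∉R = x∈p─q⇒x∉q (V G) R v∈
    escape : owner G v ≡ p ⊎ owner G v ≡ opponent p → Nonempty (Out (G ∖ R) v)
    escape (inj₁ own) with total v v∈V
    ... | u , u∈ = u , ∖-Out⁺ G R u∈ v∉R λ u∈R → v∉R (closed v (inj₁ ((v∈V , own) , u , u∈ , u∈R)))
    escape (inj₂ opp) with ⊆-or-new (Out G v) R
    ... | inj₁ Out⊆R          = ⊥-elim (v∉R (closed v (inj₂ ((v∈V , opp) , Out⊆R))))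
    ... | inj₂ (u , u∈ , u∉R) = u , ∖-Out⁺ G R u∈ v∉R u∉R

-- The edges deleted at a remaining vertex end in `Y ⊆ R`, so a vertex whose remaining successors
-- all lie in `R` already had all its successors in `R`.
Closed-swap : ∀ {G : Arena N} {Y R} → Y ⊆ R → Closed one G R → Closed two (swap (G ∖ Y)) R
Closed-swap {G = G} {Y} {R} Y⊆R closed v (inj₁ ((v∈ , own) , u , u∈ , u∈R)) =
  closed v (inj₁ ((p─q⊆p (V G) Y v∈ , opponent-two own) , u , ∖-Out⁻ G Y u∈ , u∈R))
Closed-swap {G = G} {Y} {R} Y⊆R closed v (inj₂ ((v∈ , opp) , Out⊆R)) =
  closed v (inj₂ ((p─q⊆p (V G) Y v∈ , opponent-one opp) , λ {u} u∈ → target u u∈ (u ∈? R)))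
  where
  target : ∀ u → u ∈ Out G v → Dec (u ∈ R) → u ∈ R
  target u u∈ (yes u∈R) = u∈R
  target u u∈ (no u∉R)  = Out⊆R (∖-Out⁺ G Y u∈ (x∈p─q⇒x∉q (V G) Y v∈) (u∉R ∘ Y⊆R))

-- Transfer of winning strategies from a trap to the whole game.

IsPlay⇒∈V : ∀ {G : Arena N} {π} → IsPlay G π → ∀ i → π i ∈ V G
IsPlay⇒∈V {G = G} (start , steps) i = proj₁ (E⊆V×V G (steps i))

module _ (G : Arena N) (total : Total G) where

  someMove : Fin N → Fin N
  someMove v with v ∈? V G
  ... | yes v∈ = proj₁ (total v v∈)
  ... | no _   = v

  someMove-legal : ∀ {v} → v ∈ V G → someMove v ∈ Out G v
  someMove-legal {v} v∈ with v ∈? V G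
  ... | yes v∈′ = proj₂ (total v v∈′)
  ... | no v∉   = ⊥-elim (v∉ v∈)

  -- Player `two` cannot enter the closed set `D` and the moves of `σ` avoid it, so a consistent
  -- play from outside `D` is also a play of the smaller game, with the same history. This serves
  -- for the sets removed by the algorithm and, with the players swapped, for a region `R`.
  lift : ∀ {D : Subset N} {ψ ψ′ : Objective N} → Closed two G D →
         (∀ π → (∀ i → π i ∉ D) → ψ′ π → ψ π) →
         ∀ {v} → v ∈W[ one , G ∖ D , ψ′ ] → v ∈W[ one , G , ψ ]
  lift {D} {ψ} {ψ′} closed weaken {v} (v∈ , σ , wins) = p─q⊆p (V G) D v∈ , τ , τ-wins
    where
    outside∉ : ∀ {u} → u ∈ V (G ∖ D) → u ∉ D
    outside∉ = x∈p─q⇒x∉q (V G) D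

    τ-move : List (Fin N) → Fin N → Fin N
    τ-move h u with _∈V?[_] (G ∖ D) u one
    ... | yes _ = move σ h u
    ... | no _  = someMove u

    τ : Strategy one G
    move τ = τ-move
    legal τ h u (u∈ , own) with _∈V?[_] (G ∖ D) u one
    ... | yes u∈′ = ∖-Out⁻ G D (legal σ h u u∈′)
    ... | no _    = someMove-legal u∈

    τ-agrees : ∀ h u → _∈V[_] (G ∖ D) u one → τ-move h u ≡ move σ h u
    τ-agrees h u u∈ with _∈V?[_] (G ∖ D) u one
    ... | yes _ = refl
    ... | no u∉ = ⊥-elim (u∉ u∈)

    τ-wins : ∀ π → IsPlay G π → π 0 ≡ v → Consistent one G τ π → ψ π
    τ-wins π (start , steps) start≡v cons =
      weaken π (λ i → outside∉ (stays i)) (wins π (stays 0 , steps′) start≡v cons′)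
      where
      cons-step : ∀ i → _∈V[_] (G ∖ D) (π i) one → π (suc i) ≡ move σ (past π i) (π i)
      cons-step i (πi∈ , own) =
        trans (cons i (p─q⊆p (V G) D πi∈ , own)) (τ-agrees _ _ (πi∈ , own))

      step : ∀ i → π i ∈ V (G ∖ D) → π (suc i) ∈ Out (G ∖ D) (π i)
      step i πi∈ with owner-cases (owner G (π i)) one
      ... | inj₁ own = subst (λ u → u ∈ Out (G ∖ D) (π i)) (sym (cons-step i (πi∈ , own)))
                             (legal σ _ _ (πi∈ , own))
      ... | inj₂ opp = ∖-Out⁺ G D (steps i) (outside∉ πi∈) λ u∈D →
        outside∉ πi∈ (closed _ (inj₁ ((p─q⊆p (V G) D πi∈ , opp) , _ , steps i , u∈D)))

      stays : ∀ i → π i ∈ V (G ∖ D)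
      stays zero    = subst (_∈ V (G ∖ D)) (sym start≡v) v∈
      stays (suc i) = proj₂ (E⊆V×V (G ∖ D) (step i (stays i)))

      steps′ : ∀ i → π (suc i) ∈ Out (G ∖ D) (π i)
      steps′ i = step i (stays i)

      cons′ : Consistent one (G ∖ D) σ π
      cons′ = cons-step

-- Regions and their positional strategies.

module _ {N : ℕ} (G : Arena N) (total : Total G) (L : Fin k₁ → Subset N) where

  -- `Region T R` certifies that player 1 has a positional strategy under which
  -- every play from R reaches T or violates some Büchi(L t). In `confine`,
  -- the play may remain in B forever, but then it avoids L t.
  data Region (T : Subset N) : Subset N → Set where
    goal    : Region T T
    attract : ∀ {R} → Region T R → ∀ B →
              (∀ v → v ∈ B → Attracted one G R v) → Region T (R ∪ B)
    confine : ∀ {R} → Region T R → ∀ t B →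
              (∀ v → v ∈ B → v ∉ L t × Attracted one G (R ∪ B) v) → Region T (R ∪ B)

  target : ∀ {R v} → Attracted one G R v → Fin N
  target {v = v} (inj₁ (_ , u , _)) = u
  target {v = v} (inj₂ _)           = someMove G total v

  target-legal : ∀ {R v} (att : Attracted one G R v) → target att ∈ Out G v
  target-legal (inj₁ (_ , _ , u∈ , _)) = u∈
  target-legal (inj₂ ((v∈ , _) , _))   = someMove-legal G total v∈

  target-enters : ∀ {R v u} (att : Attracted one G R v) → u ∈ Out G v →
                  (owner G v ≡ one → u ≡ target att) → u ∈ R
  target-enters (inj₁ ((_ , own) , _ , _ , u∈R)) _ follows = subst (_∈ _) (sym (follows own)) u∈R
  target-enters (inj₂ (_ , Out⊆R)) u∈ _ = Out⊆R u∈

  module _ {R R′ B : Subset N} (att : ∀ v → v ∈ B → Attracted one G R′ v) (f : Fin N → Fin N) where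

    -- Moves from `B` lead into `R′`, which is `R` for `attract` and `R ∪ B` for `confine`. Where
    -- `R` and `B` overlap the old move takes precedence, so the strategy of the smaller region is
    -- preserved.
    extend : Fin N → Fin N
    extend v with v ∈? R
    ... | yes _ = f v
    ... | no _ with v ∈? B
    ...   | yes v∈B = target (att v v∈B)
    ...   | no _    = someMove G total v

    extend-legal : (∀ v → v ∈ V G → f v ∈ Out G v) → ∀ v → v ∈ V G → extend v ∈ Out G v
    extend-legal f-legal v v∈ with v ∈? R
    ... | yes _ = f-legal v v∈
    ... | no _ with v ∈? B
    ...   | yes v∈B = target-legal (att v v∈B)
    ...   | no _    = someMove-legal G total v∈

    extend-old : ∀ {v} → v ∈ R → extend v ≡ f v
    extend-old {v} v∈R with v ∈? R
    ... | yes _  = refl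
    ... | no v∉R = ⊥-elim (v∉R v∈R)

    extend-new : ∀ {v u} → v ∉ R → v ∈ B → u ∈ Out G v →
                 (owner G v ≡ one → u ≡ extend v) → u ∈ R′
    extend-new {v} v∉R v∈B u∈ follows with v ∈? R
    ... | yes v∈R = ⊥-elim (v∉R v∈R)
    ... | no _ with v ∈? B
    ...   | yes v∈B′ = target-enters (att v v∈B′) u∈ follows
    ...   | no v∉B   = ⊥-elim (v∉B v∈B)

  regionMove : ∀ {T R} → Region T R → Fin N → Fin N
  regionMove goal                    = someMove G total
  regionMove (attract {R} r B att)   = extend {R} att (regionMove r)
  regionMove (confine {R} r t B att)   = extend {R} (λ v → proj₂ ∘ att v) (regionMove r)

  regionMove-legal : ∀ {T R} (r : Region T R) v → v ∈ V G → regionMove r v ∈ Out G v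
  regionMove-legal goal v v∈              = someMove-legal G total v∈
  regionMove-legal (attract {R} r B att)   = extend-legal {R} att (regionMove r) (regionMove-legal r)
  regionMove-legal (confine {R} r t B att) =
    extend-legal {R} (λ v → proj₂ ∘ att v) (regionMove r) (regionMove-legal r)

  -- P says at which times the strategy of the region is in force.
  module _ {T : Subset N} {π : Play N} (steps : ∀ i → π (suc i) ∈ Out G (π i))
           (fair : GenBüchi L π) (P : ℕ → Set) where

    -- Nothing is demanded once `T` is hit, since the cyclic strategy then switches to its next
    -- target. Until then `P` persists, so it still holds at the hit.
    Follows : ∀ {R} → Region T R → Set
    Follows {R} r = ∀ i → P i → π i ∉ T →
      P (suc i) × (π i ∈ R → owner G (π i) ≡ one → π (suc i) ≡ regionMove r (π i))

    Hits : ℕ → Set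
    Hits i = ∃[ j ] (i ≤ j × P j × π j ∈ T)

    later : ∀ {i} → Hits (suc i) → Hits i
    later (j , i<j , hits) = j , ≤-trans (n≤1+n _) i<j , hits

    private
      new : ∀ {v} {R B : Subset N} → v ∈ R ∪ B → v ∉ R → v ∈ B
      new {R = R} {B} v∈ v∉R with x∈p∪q⁻ R B v∈
      ... | inj₁ v∈R = ⊥-elim (v∉R v∈R)
      ... | inj₂ v∈B = v∈B

    -- Induction on the certificate. An attracted vertex reaches `R` in one step; a play in a
    -- confined `B` must leave it for `R` or meet `T`, because `fair` forces a visit to `L t`, which
    -- `B` avoids.
    hit : ∀ {R} (r : Region T R) → Follows r → ∀ i → P i → π i ∈ R → Hits i
    hit goal follows i now πi∈ = i , ≤-refl , now , πi∈
    hit (attract {R} r B att) follows i now πi∈ = by-cases (π i ∈? T) (π i ∈? R)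
      where
      inner : Follows r
      inner i now πi∉T with follows i now πi∉T
      ... | now′ , eq = now′ , λ πi∈R own →
        trans (eq (p⊆p∪q B πi∈R) own) (extend-old {R} att (regionMove r) πi∈R)

      by-cases : Dec (π i ∈ T) → Dec (π i ∈ R) → Hits i
      by-cases (yes πi∈T) _          = i , ≤-refl , now , πi∈T
      by-cases (no _)     (yes πi∈R) = hit r inner i now πi∈R
      by-cases (no πi∉T)  (no πi∉R) with follows i now πi∉T
      ... | now′ , eq = later (hit r inner (suc i) now′
        (extend-new {R} att (regionMove r) πi∉R (new πi∈ πi∉R) (steps i) (eq πi∈)))
    hit (confine {R} r t B att) follows i now πi∈ = start (fair t i)
      where
      inner : Follows r
      inner i now πi∉T with follows i now πi∉T
      ... | now′ , eq = now′ , λ πi∈R own →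
        trans (eq (p⊆p∪q B πi∈R) own) (extend-old {R} _ (regionMove r) πi∈R)

      -- `d` is the time left until a visit to `L t`; at `d = 0` the play cannot be in `B`.
      by-cases : ∀ d i → P i → π i ∈ R ∪ B → π (i + d) ∈ L t → Dec (π i ∈ T) → Dec (π i ∈ R) → Hits i
      by-cases d i now πi∈ πj∈L (yes πi∈T) _          = i , ≤-refl , now , πi∈T
      by-cases d i now πi∈ πj∈L (no _)     (yes πi∈R) = hit r inner i now πi∈R
      by-cases zero i now πi∈ πj∈L (no _) (no πi∉R) =
        ⊥-elim (proj₁ (att _ (new πi∈ πi∉R)) (subst (λ j → π j ∈ L t) (+-identityʳ i) πj∈L))
      by-cases (suc d) i now πi∈ πj∈L (no πi∉T) (no πi∉R) with follows i now πi∉T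
      ... | now′ , eq = later (by-cases d (suc i) now′
        (extend-new {R} _ (regionMove r) πi∉R (new πi∈ πi∉R) (steps i) (eq πi∈))
        (subst (λ j → π j ∈ L t) (+-suc i d) πj∈L) (π (suc i) ∈? T) (π (suc i) ∈? R))

      start : ∃[ j ] (i ≤ j × π j ∈ L t) → Hits i
      start (j , i≤j , πj∈L) with m≤n⇒∃[o]m+o≡n i≤j
      ... | d , refl = by-cases d i now πi∈ πj∈L (π i ∈? T) (π i ∈? R)

  -- The strategy pursuing all targets in cyclic order.

  Covered : Subset N → Set
  Covered T = ∃[ R ] (Region T R × V G ⊆ R)

  module _ {m : ℕ} (U : Fin (suc m) → Subset N) (regions : ∀ ℓ → Covered (U ℓ)) where

    private
      region : ∀ ℓ → Region (U ℓ) (proj₁ (regions ℓ))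
      region ℓ = proj₁ (proj₂ (regions ℓ))

    tick : {A : Set} → Dec A → ℕ → ℕ
    tick (yes _) c = suc c
    tick (no _)  c = c

    -- The number of targets reached so far; the current one is `U (c mod suc m)`.
    counter : List (Fin N) → ℕ
    counter []      = 0
    counter (v ∷ h) = tick (v ∈? U (counter h mod suc m)) (counter h)

    cyclic : Strategy one G
    move cyclic h v             = regionMove (region (counter h mod suc m)) v
    legal cyclic h v (v∈ , own) = regionMove-legal (region (counter h mod suc m)) v v∈

    module _ {π : Play N} (play : IsPlay G π) (cons : Consistent one G cyclic π)
             (fair : GenBüchi L π) where

      private
        count : ℕ → ℕ
        count i = counter (past π i)

        tick-yes : ∀ {c i} → count i ≡ c → π i ∈ U (c mod suc m) → count (suc i) ≡ suc c
        tick-yes {i = i} refl πi∈ with π i ∈? U (count i mod suc m)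
        ... | yes _  = refl
        ... | no πi∉ = ⊥-elim (πi∉ πi∈)

        tick-no : ∀ {c i} → count i ≡ c → π i ∉ U (c mod suc m) → count (suc i) ≡ c
        tick-no {i = i} refl πi∉ with π i ∈? U (count i mod suc m)
        ... | yes πi∈ = ⊥-elim (πi∉ πi∈)
        ... | no _    = refl

      -- The counter stays at `c` until the current target is hit, so a single region's strategy is
      -- in force meanwhile; hence the choice of `count j ≡ c` for `P j`.
      next-hit : ∀ {c} i → count i ≡ c → ∃[ j ] (i ≤ j × count j ≡ c × π j ∈ U (c mod suc m))
      next-hit {c} i eq =
        hit (proj₂ play) fair (λ j → count j ≡ c) (region (c mod suc m)) follows i eq
            (proj₂ (proj₂ (regions (c mod suc m))) (IsPlay⇒∈V {G = G} play i))
        where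
        follows : ∀ j → count j ≡ c → π j ∉ U (c mod suc m) → count (suc j) ≡ c × _
        follows j refl πj∉ = tick-no refl πj∉ , λ _ own → cons j (IsPlay⇒∈V {G = G} play j , own)

      reach : ∀ d i → ∃[ j ] (i ≤ j × count j ≡ d + count i)
      reach zero    i = i , ≤-refl , refl
      reach (suc d) i with reach d i
      ... | j , i≤j , eq with next-hit j eq
      ...   | j′ , j≤j′ , eq′ , πj′∈ =
        suc j′ , ≤-trans i≤j (≤-trans j≤j′ (n≤1+n _)) , tick-yes eq′ πj′∈

      all-hit : GenBüchi U π
      -- This increment brings the counter to `toℕ ℓ + count i * suc m`, which is congruent to `ℓ`
      -- modulo `suc m`.
      all-hit ℓ i with reach (toℕ ℓ + count i * m) i
      ... | j , i≤j , eq with next-hit j eq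
      ...   | j′ , j≤j′ , _ , πj′∈ =
        j′ , ≤-trans i≤j j≤j′ , subst (λ ℓ → π j′ ∈ U ℓ) idx πj′∈
        where
        idx : ((toℕ ℓ + count i * m) + count i) mod suc m ≡ ℓ
        idx = trans (cong (_mod suc m) (trans (+-assoc (toℕ ℓ) (count i * m) (count i))
                (cong (toℕ ℓ +_) (trans (+-comm (count i * m) (count i)) (sym (*-suc (count i) m))))))
              (toℕ-mod ℓ (count i))

  covered⇒GR1 : (U : Fin k₂ → Subset N) → (∀ ℓ → Covered (U ℓ)) →
                ∀ {v} → v ∈ V G → v ∈W[ one , G , GR1 L U ]
  -- A cyclic order needs a target; with none, `GenBüchi U` is vacuous and any strategy wins.
  covered⇒GR1 {k₂ = zero} U _ v∈ = v∈ ,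
    record { move = λ _ → someMove G total ; legal = λ _ _ v∈ → someMove-legal G total (proj₁ v∈) } ,
    λ _ _ _ _ _ ()
  covered⇒GR1 {k₂ = suc m} U regions v∈ = v∈ , cyclic U regions ,
    λ _ play _ cons fair → all-hit U regions play cons fair

  Attr-region : ∀ T → Region T (Attr one G T)
  Attr-region T = stage N
    where
    stage : ∀ i → Region T (attrStage one G T i)
    stage zero    = goal
    stage (suc i) = attract (stage i) _ (λ v → ∈⟨⟩⁻ (attracted? one G _))

-- With no premise sets GR(1) is the generalized Büchi objective, and attractors serve as regions.
-- Player 2 obtains a cyclic strategy this way, in a swapped game.
covered⇒GenBüchi : ∀ (G : Arena N) (total : Total G) (T : Fin k → Subset N) →
                   (∀ t → V G ⊆ Attr one G (T t)) →
                   ∀ {v} → v ∈ V G → v ∈W[ one , G , GenBüchi T ]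
covered⇒GenBüchi {N = N} G total T covers v∈ with
  covered⇒GR1 G total none T (λ t → Attr one G (T t) , Attr-region G total none (T t) , covers t) v∈
  where
  none : Fin 0 → Subset N
  none ()
... | v∈′ , σ , wins = v∈′ , σ , λ π play start cons → wins π play start cons λ ()

-- Enlarging a region until it covers the game.

module _ {N : ℕ} (G : Arena N) (total : Total G) (L : Fin k₁ → Subset N) (T : Subset N) where

  private
    Y : Subset N
    Y = Attr one G T

  module _ (unwinnable : ∀ v → ¬ v ∈W[ one , swap (G ∖ Y) , GenBüchi (λ t → L t ─ Y) ]) where

    private
      larger : ∀ {R B : Subset N} {v} → v ∈ B → v ∉ R → R ⊂ R ∪ B
      larger {R} {B} {v} v∈B v∉R = p⊆p∪q B , v , q⊆p∪q R B v∈B , v∉R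

    -- Attraction is tried first, so that `R` is closed when the remainder is inspected: this makes
    -- `H` total and bars player 1 from moving from `H` into `R`.
    grow : ∀ {R} → Y ⊆ R → Region G total L T R →
           V G ⊆ R ⊎ (∃[ R′ ] (R ⊂ R′ × Region G total L T R′))
    grow {R} Y⊆R r with ⊆-or-new ⟨ attracted? one G R ⟩ R
    ... | inj₂ (v , v∈ , v∉R) =
      inj₂ (_ , larger v∈ v∉R , attract r _ (λ v → ∈⟨⟩⁻ (attracted? one G R)))
    ... | inj₁ ⊆R = stuck (any? λ t → nonempty? (V H ─ A t))
      where
      closed : Closed one G R
      closed v att = ⊆R (∈⟨⟩⁺ (attracted? one G R) att)

      -- The players are swapped here: `one` of `H₀` and `H` is player 2 of `G`, so `A t` is where
      -- player 2 can force a visit to `L t` inside `H`.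
      H₀ H : Arena N
      H₀ = swap (G ∖ Y)
      H  = H₀ ∖ R

      total₀ : Total H₀
      total₀ = Total-∖ one G total (Attr-closed one G T)

      closed₀ : Closed two H₀ R
      closed₀ = Closed-swap {G = G} Y⊆R closed

      totalH : Total H
      totalH = Total-∖ two H₀ total₀ closed₀

      L′ : Fin _ → Subset N
      L′ t = L t ─ Y ─ R

      A : Fin _ → Subset N
      A t = Attr one H (L′ t)

      ∉R : ∀ {v} → v ∈ V H → v ∉ R
      ∉R = x∈p─q⇒x∉q (V G ─ Y) R

      H-Out⁺ : ∀ {v u} → u ∈ Out G v → v ∉ R → u ∉ R → u ∈ Out H v
      H-Out⁺ u∈ v∉R u∉R = ∖-Out⁺ H₀ R (∖-Out⁺ G Y u∈ (v∉R ∘ Y⊆R) (u∉R ∘ Y⊆R)) v∉R u∉R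

      H-Out⁻ : ∀ {v u} → u ∈ Out H v → u ∈ Out G v
      H-Out⁻ u∈ = ∖-Out⁻ G Y (∖-Out⁻ H₀ R u∈)

      -- Outside the attractor `A t`, player 1 has a successor that stays outside, while player 2
      -- can only stay outside or move to `R`. All vertices of `L t` in `H` belong to `A t`.
      trap : ∀ t v → v ∈ V H ─ A t → v ∉ L t × Attracted one G (R ∪ (V H ─ A t)) v
      trap t v v∈ = v∉L , attracted (owner-cases (owner G v) one)
        where
        B : Subset N
        B = V H ─ A t
        v∈H : v ∈ V H
        v∈H = p─q⊆p (V H) (A t) v∈
        v∉A : v ∉ A t
        v∉A = x∈p─q⇒x∉q (V H) (A t) v∈
        v∈V : v ∈ V G
        v∈V = p─q⊆p (V G) Y (p─q⊆p (V G ─ Y) R v∈H)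
        v∉L : v ∉ L t
        v∉L v∈L = v∉A (Attr-⊇ one H (L′ t)
          (x∈p∧x∉q⇒x∈p─q (x∈p∧x∉q⇒x∈p─q v∈L (∉R v∈H ∘ Y⊆R)) (∉R v∈H)))
        attracted : owner G v ≡ one ⊎ owner G v ≡ two → Attracted one G (R ∪ B) v
        attracted (inj₁ own) with ⊆-or-new (Out H v) (A t)
        ... | inj₁ Out⊆A = ⊥-elim (v∉A (Attr-closed one H (L′ t) v
          (inj₂ ((v∈H , cong opponent own) , Out⊆A))))
        ... | inj₂ (u , u∈ , u∉A) = inj₁ ((v∈V , own) , u , H-Out⁻ u∈ ,
          q⊆p∪q R B (x∈p∧x∉q⇒x∈p─q (proj₂ (E⊆V×V H u∈)) u∉A))
        attracted (inj₂ opp) = inj₂ ((v∈V , opp) , λ {u} u∈ → remains u u∈ (u ∈? R))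
          where
          remains : ∀ u → u ∈ Out G v → Dec (u ∈ R) → u ∈ R ∪ B
          remains u u∈ (yes u∈R) = p⊆p∪q B u∈R
          remains u u∈ (no u∉R)  = q⊆p∪q R B (x∈p∧x∉q⇒x∈p─q (proj₂ (E⊆V×V H u∈H)) λ u∈A →
            v∉A (Attr-closed one H (L′ t) v (inj₁ ((v∈H , cong opponent opp) , u , u∈H , u∈A))))
            where
            u∈H : u ∈ Out H v
            u∈H = H-Out⁺ u∈ (∉R v∈H) u∉R

      -- Player 2 could visit the sets `L t` in turn forever inside `H`, and player 1 cannot escape
      -- from `H` to `R`, so player 2 would win in `H₀`, against `unwinnable`.
      H-empty : (∀ t → V H ⊆ A t) → ∀ v → v ∉ V H
      H-empty covers v v∈ = unwinnable v
        (lift H₀ total₀ closed₀ (λ _ _ wins t i → enlarge t (wins t i))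
              (covered⇒GenBüchi H totalH L′ covers v∈))
        where
        enlarge : ∀ {π : Play N} {i} t → ∃[ j ] (i ≤ j × π j ∈ L′ t) → ∃[ j ] (i ≤ j × π j ∈ L t ─ Y)
        enlarge t (j , i≤j , πj∈) = j , i≤j , p─q⊆p (L t ─ Y) R πj∈

      stuck : Dec (∃[ t ] Nonempty (V H ─ A t)) → V G ⊆ R ⊎ (∃[ R′ ] (R ⊂ R′ × Region G total L T R′))
      stuck (yes (t , v , v∈)) =
        inj₂ (_ , larger v∈ (∉R (p─q⊆p (V H) (A t) v∈)) , confine r t _ (trap t))
      stuck (no none) with ⊆-or-new (V G) R
      ... | inj₁ V⊆R = inj₁ V⊆R
      ... | inj₂ (v , v∈ , v∉R) = ⊥-elim (H-empty covers v
              (x∈p∧x∉q⇒x∈p─q (x∈p∧x∉q⇒x∈p─q v∈ (v∉R ∘ Y⊆R)) v∉R))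
        where
        covers : ∀ t → V H ⊆ A t
        covers t with ⊆-or-new (V H) (A t)
        ... | inj₁ V⊆A = V⊆A
        ... | inj₂ (u , u∈ , u∉A) = ⊥-elim (none (t , u , x∈p∧x∉q⇒x∈p─q u∈ u∉A))

    -- `n` is fuel: each round adds a vertex to `R`, which preserves the bound, and at `n = 0` the
    -- bound contradicts `∣ R ∣ ≤ N`.
    grow* : ∀ n {R} → N < n + ∣ R ∣ → Y ⊆ R → Region G total L T R → Covered G total L T
    grow* zero {R} N<∣R∣ _ _ = ⊥-elim (<⇒≱ N<∣R∣ (∣p∣≤n R))
    grow* (suc n) {R} N<n+∣R∣ Y⊆R r with grow Y⊆R r
    ... | inj₁ V⊆R = R , r , V⊆R
    ... | inj₂ (R′ , R⊂R′ , r′) = grow* n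
      (≤-trans N<n+∣R∣ (≤-trans (≤-reflexive (sym (+-suc n ∣ R ∣))) (+-monoʳ-≤ n (p⊂q⇒∣p∣<∣q∣ R⊂R′))))
      (proj₁ R⊂R′ ∘ Y⊆R) r′

    unwinnable⇒covered : Covered G total L T
    unwinnable⇒covered = grow* (suc N) (s≤s (m≤m+n N ∣ Y ∣)) (λ v∈ → v∈) (Attr-region G total L T)

-- Soundness of the set returned by the algorithm.

Empty-orElse : ∀ (S T : Subset N) → Empty (S orElse T) → Empty S × Empty T
Empty-orElse S T empty with nonempty? S
... | yes S≠∅ = ⊥-elim (empty S≠∅)
... | no S=∅  = S=∅ , empty

Empty-firstNonempty : ∀ {S : Subset N} Ss → Empty (firstNonempty Ss) → S List.∈ Ss → Empty S
Empty-firstNonempty (S ∷ Ss) empty (here refl) = proj₁ (Empty-orElse S _ empty)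
Empty-firstNonempty (S ∷ Ss) empty (there S∈)  =
  Empty-firstNonempty Ss (proj₂ (Empty-orElse S _ empty)) S∈

─-mono : ∀ {p q : Subset N} r → p ⊆ q → p ─ r ⊆ q ─ r
─-mono {p = p} {q} r p⊆q x∈ =
  x∈p∧x∉q⇒x∈p─q (p⊆q (p─q⊆p p r x∈)) (x∈p─q⇒x∉q p r x∈)

module _ {N k₁ k₂ : ℕ} (order : (H : Arena N) → InEdgeOrder H) (solver : GenBüchiGame N)
         (measure : GenBüchiProgressMeasure N) where

  open Algorithm {N} {k₁} {k₂} order solver measure
  open GenBüchiGame solver using (solve; correct)

  -- The loop invariant that yields the preconditions of `correct` for each game passed to `solve`.
  WellFormed : State → Set
  WellFormed s = Total (graph s) × (∀ t → L s t ⊆ V (graph s))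

  next-wellFormed : ∀ s n → WellFormed s → WellFormed (next s n)
  next-wellFormed s n (total , L⊆V) =
    Total-∖ two (graph s) total (Attr-closed two (graph s) (S s n)) , λ t → ─-mono (D s n) (L⊆V t)

  -- `D` is an attractor of player 2, hence closed, and on plays avoiding `D` its removal from the
  -- target sets changes no Büchi condition.
  next-lift : ∀ s n → WellFormed s → ∀ {v} →
    v ∈W[ one , graph (next s n) , GR1 (L (next s n)) (U (next s n)) ] →
    v ∈W[ one , graph s , GR1 (L s) (U s) ]
  next-lift s n (total , _) = lift (graph s) total (Attr-closed two (graph s) (S s n)) weaken
    where
    weaken : ∀ π → (∀ i → π i ∉ D s n) → GR1 (L (next s n)) (U (next s n)) π → GR1 (L s) (U s) π
    weaken π avoids wins fair ℓ i with wins fair′ ℓ i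
      where
      fair′ : GenBüchi (L (next s n)) π
      fair′ t i with fair t i
      ... | j , i≤j , πj∈ = j , i≤j , x∈p∧x∉q⇒x∈p─q πj∈ (avoids j)
    ... | j , i≤j , πj∈ = j , i≤j , p─q⊆p (U s ℓ) (D s n) πj∈

  -- Since `S` is contained in `D`, it is empty, and so is every set computed by `solve` in the
  -- fallback; by `correct`, player 2 wins from no vertex of these games.
  stopped-winning : ∀ s n → WellFormed s → Empty (D s n) → ∀ {v} → v ∈ V (graph s) →
    v ∈W[ one , graph s , GR1 (L s) (U s) ]
  stopped-winning s n (total , L⊆V) D=∅ =
    covered⇒GR1 (graph s) total (L s) (U s) λ ℓ → unwinnable⇒covered (graph s) total (L s) (U s ℓ) (unwinnable ℓ)
    where
    fallback=∅ : Empty (S-fallback s)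
    fallback=∅ = proj₂ (Empty-orElse (kGenBüchiDominion s n) _
      λ (v , v∈) → D=∅ (v , Attr-⊇ two (graph s) (S s n) v∈))

    unwinnable : ∀ ℓ v →
      ¬ v ∈W[ one , swap (graph s ∖ Y s ℓ) , GenBüchi (λ t → L s t ─ Y s ℓ) ]
    unwinnable ℓ v v∈W =
      Empty-firstNonempty _ fallback=∅ (∈-map⁺ _ (∈-allFin ℓ))
        (v , Equivalence.from (correct (swap (graph s ∖ Y s ℓ)) (λ t → L s t ─ Y s ℓ)
               (Total-∖ one (graph s) total (Attr-closed one (graph s) (U s ℓ)))
               (λ t → ─-mono (Y s ℓ) (L⊆V t)) v)
             v∈W)

  module _ (G : Arena N) (total : Total G) {L₀ : Fin k₁ → Subset N} (L⊆V : ∀ t → L₀ t ⊆ V G)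
           (U₀ : Fin k₂ → Subset N) where

    open Run G L₀ U₀

    iteration-wellFormed : ∀ j → WellFormed (iteration j)
    iteration-wellFormed zero    = total , L⊆V
    iteration-wellFormed (suc j) = next-wellFormed (iteration j) ∣ V G ∣ (iteration-wellFormed j)

    iteration-lift : ∀ j {v} →
      v ∈W[ one , graph (iteration j) , GR1 (L (iteration j)) (U (iteration j)) ] →
      v ∈W[ one , G , GR1 L₀ U₀ ]
    iteration-lift zero    v∈W = v∈W
    iteration-lift (suc j) v∈W =
      iteration-lift j (next-lift (iteration j) ∣ V G ∣ (iteration-wellFormed j) v∈W)

lemma5p21 : ∀ {N k₁ k₂ : ℕ}
    (order : (H : Arena N) → InEdgeOrder H)
    (solver : GenBüchiGame N)
    (measure : GenBüchiProgressMeasure N)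
    (G : Arena N) → Total G →
    (L : Fin k₁ → Subset N) → (∀ t → L t ⊆ V G) →
    (U : Fin k₂ → Subset N) → (∀ ℓ → U ℓ ⊆ V G) →
    let open Algorithm.Run {N} {k₁} {k₂} order solver measure G L U in
    (j* : ℕ) → StopsAt j* →
    ∀ v → v ∈ Vʲ j* → v ∈W[ one , G , GR1 L U ]
lemma5p21 order solver measure G total L L⊆V U _ j* (D=∅ , _) v v∈ =
  iteration-lift order solver measure G total L⊆V U j*
    (stopped-winning order solver measure _ ∣ V G ∣
      (iteration-wellFormed order solver measure G total L⊆V U j*) D=∅ v∈)
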